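{- Let $T_1$ and $T_2$ be finite trees such that $P_3(T_1)$ is isomorphic to $P_3(T_2)$ and this graph is not a complete graph. Then $T_1$ is isomorphic to $T_2$. That is, a tree is uniquely determined (up to isomorphism) by its third power, provided the third power is not complete.
   Context: For a graph $G$, its third power (cube) $P_3(G)$ is the graph on the same vertex set in which two distinct vertices are adjacent if and only if their distance in $G$ is at most $3$. -}

module Defs where

open import Data.Nat using (ℕ; zero; suc; _≤_; _≥_)
open import Data.Fin using (Fin)
open import Data.List using (List; []; _∷_; length; _++_)
open import Data.List.Relation.Unary.Unique.Propositional using (Unique)
open import Data.Product using (Σ; _×_; _,_; ∃-syntax; proj₁)
open import Data.Sum using (_⊎_)
open import Relation.Nullary using (¬_)
open import Relation.Binary.PropositionalEquality using (_≡_; refl) renaming (sym to ≡-sym)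
open import Function.Bundles using (_↔_; Inverse)

record Graph (n : ℕ) : Set₁ where
  field
    Adj     : Fin n → Fin n → Set
    irrefl  : ∀ v → ¬ Adj v v
    sym     : ∀ {u v} → Adj u v → Adj v u

open Graph public

data Walk {n : ℕ} (G : Graph n) : Fin n → Fin n → ℕ → Set where
  here : ∀ {u} → Walk G u u zero
  step : ∀ {u w v k} → Adj G u w → Walk G w v k → Walk G u v (suc k)

DistLe : ∀ {n} → Graph n → ℕ → Fin n → Fin n → Set
DistLe G d u v = ∃[ k ] (k ≤ d × Walk G u v k)

Connected : ∀ {n} → Graph n → Set
Connected G = ∀ u v → ∃[ k ] Walk G u v k

data Chain {n : ℕ} (G : Graph n) : List (Fin n) → Set where
  one  : ∀ {v} → Chain G (v ∷ [])
  cons : ∀ {u v vs} → Adj G u v → Chain G (v ∷ vs) → Chain G (u ∷ v ∷ vs)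

-- A cycle: a list of pairwise distinct vertices v₀ … v_k with k ≥ 2
-- (at least 3 vertices), consecutive ones adjacent, and v_k adjacent to v₀
-- (encoded as: the closed list v₀ … v_k v₀ is a chain).
record Cycle {n : ℕ} (G : Graph n) : Set where
  field
    start : Fin n
    rest  : List (Fin n)
    uniq  : Unique (start ∷ rest)
    long  : length rest ≥ 2
    chain : Chain G (start ∷ (rest ++ (start ∷ [])))

IsTree : ∀ {n} → Graph n → Set
IsTree G = Connected G × ¬ Cycle G

P3 : ∀ {n} → Graph n → Graph n
P3 {n} G = record
  { Adj    = λ u v → ¬ (u ≡ v) × DistLe G 3 u v
  ; irrefl = λ v p → proj₁ p refl
  ; sym    = λ { (ne , k , le , w) → (λ e → ne (≡-sym e)) , k , le , reverse w }
  }
  where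
  snoc : ∀ {u v w k} → Walk G u v k → Adj G v w → Walk G u w (suc k)
  snoc here a = step a here
  snoc (step b w) a = step b (snoc w a)
  reverse : ∀ {u v k} → Walk G u v k → Walk G v u k
  reverse here = here
  reverse (step a w) = snoc (reverse w) (Graph.sym G a)

IsComplete : ∀ {n} → Graph n → Set
IsComplete {n} G = ∀ (u v : Fin n) → ¬ (u ≡ v) → Adj G u v

_≅_ : ∀ {n m} → Graph n → Graph m → Set
_≅_ {n} {m} G H = Σ (Fin n ↔ Fin m) λ f →
  ∀ u v → (Adj G u v → Adj H (Inverse.to f u) (Inverse.to f v))
        × (Adj H (Inverse.to f u) (Inverse.to f v) → Adj G u v)

{-# OPTIONS --safe #-}
module Submission where

-- Transport both trees to one vertex set, so that they have the same cube.
-- If a and d are at distance 4 with midpoint m, their common neighbours in the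
-- cube are exactly the closed neighbourhood of m, and pairs at distance 4 are
-- the non-adjacent pairs of the cube with at least three common neighbours.
-- So the closed neighbourhoods of midpoints are the same sets in both trees.
-- A vertex in none of them ("uncovered") is a leaf, and two uncovered leaves
-- have the same neighbour iff they coincide or are adjacent in the cube.  Every
-- edge has an end that is a midpoint or uncovered.  Hence "midpoint of (a, d) in the
-- first tree ↦ midpoint of (a, d) in the second", "neighbour of an uncovered w ↦
-- neighbour of w" and "uncovered w ↦ w" define a partial bijection, and any
-- extension of it to a permutation that keeps each vertex in the same closed
-- neighbourhoods is an isomorphism.  The extension is a product of transpositions.

open import Defs
open import Data.Empty using (⊥-elim)
open import Data.Fin using (Fin)
open import Data.Fin.Permutation as Perm using (Permutation; Permutation′; _⟨$⟩ʳ_; _⟨$⟩ˡ_; _∘ₚ_)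
open import Data.Fin.Permutation.Components using (transpose)
open import Data.Fin.Properties using (_≟_; any?; all?; ¬∀⟶∃¬)
open import Data.List using (List; []; _∷_; _++_; allFin)
open import Data.List.Membership.Propositional using (_∈_)
open import Data.List.Membership.Propositional.Properties using (∈-∃++; ∈-allFin)
open import Data.List.Relation.Unary.All as All using ([]; _∷_)
open import Data.List.Relation.Unary.All.Properties as All using (++⁻ˡ; ++⁻ʳ; ¬Any⇒All¬)
open import Data.List.Relation.Unary.AllPairs using ([]; _∷_)
open import Data.List.Relation.Unary.Any using (here; there)
open import Data.List.Relation.Unary.Unique.Propositional using (Unique)
open import Data.Nat using (ℕ; zero; suc; _+_; _≤_; _<_; _≤?_; z≤n; s≤s; s≤s⁻¹)
import Data.Nat.Properties as ℕ
open import Data.Product using (∃; ∃₂; _×_; _,_; proj₁; proj₂)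
open import Data.Sum as Sum using (_⊎_; inj₁; inj₂)
open import Function using (_∘_)
open import Function.Bundles using (Inverse)
open import Relation.Nullary using (¬_; Dec; yes; no; contradiction)
open import Relation.Nullary.Decidable using (map′; _×-dec_; _⊎-dec_; ¬?)
open import Relation.Binary.Definitions using (Reflexive; Symmetric; Transitive)
open import Relation.Binary.PropositionalEquality as ≡ using (_≡_; _≢_; refl)

-- Extending a partial injection to a permutation

transpose-≢ : ∀ {n} (i j : Fin n) {k} → k ≢ i → k ≢ j → transpose i j k ≡ k
transpose-≢ i j {k} k≢i k≢j with k ≟ i
... | yes k≡i = contradiction k≡i k≢i
... | no  _ with k ≟ j
...   | yes k≡j = contradiction k≡j k≢j
...   | no  _   = refl

transpose-left : ∀ {n} (i j : Fin n) → transpose i j i ≡ j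
transpose-left i j with i ≟ i
... | yes _   = refl
... | no  i≢i = contradiction refl i≢i

permutation-injective : ∀ {n m} (ψ : Permutation n m) {u v} → ψ ⟨$⟩ʳ u ≡ ψ ⟨$⟩ʳ v → u ≡ v
permutation-injective ψ eq =
  ≡.trans (≡.sym (Perm.inverseˡ ψ)) (≡.trans (≡.cong (ψ ⟨$⟩ˡ_) eq) (Perm.inverseˡ ψ))

-- Each matched pair not yet respected is repaired by composing with one
-- transposition; injectivity of S protects the pairs already treated.
module _ {n} {S R : Fin n → Fin n → Set}
  (image?     : ∀ s → Dec (∃ (S s)))
  (functional : ∀ {s t t′} → S s t → S s t′ → t ≡ t′)
  (injective  : ∀ {s s′ t} → S s t → S s′ t → s ≡ s′)
  (S⇒R        : ∀ {s t} → S s t → R s t)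
  (R-refl : Reflexive R) (R-sym : Symmetric R) (R-trans : Transitive R)
  where

  transpose-related : ∀ {i j} → R i j → ∀ k → R k (transpose i j k)
  transpose-related {i} {j} r k with k ≟ i
  ... | yes refl = r
  ... | no  _ with k ≟ j
  ...   | yes refl = R-sym r
  ...   | no  _    = R-refl

  extend-on : ∀ xs → ∃ λ (ψ : Permutation′ n) →
              (∀ {s t} → s ∈ xs → S s t → ψ ⟨$⟩ʳ s ≡ t) × (∀ v → R v (ψ ⟨$⟩ʳ v))
  extend-on [] = Perm.id , (λ ()) , λ _ → R-refl
  extend-on (x ∷ xs) with extend-on xs | image? x
  ... | ψ , ext , rel | no ∄t =
    ψ , (λ { (here refl) Sst → contradiction (_ , Sst) ∄t ; (there s∈) → ext s∈ }) , rel
  ... | ψ , ext , rel | yes (t , Sxt) = ψ ∘ₚ Perm.transpose (ψ ⟨$⟩ʳ x) t , ext′ , rel′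
    where
    x↦t : transpose (ψ ⟨$⟩ʳ x) t (ψ ⟨$⟩ʳ x) ≡ t
    x↦t = transpose-left (ψ ⟨$⟩ʳ x) t

    ext′ : ∀ {s u} → s ∈ x ∷ xs → S s u → transpose (ψ ⟨$⟩ʳ x) t (ψ ⟨$⟩ʳ s) ≡ u
    ext′ (here refl) Ssu = ≡.trans x↦t (functional Sxt Ssu)
    ext′ {s} {u} (there s∈) Ssu with s ≟ x
    ... | yes refl = ≡.trans x↦t (functional Sxt Ssu)
    ... | no  s≢x  = ≡.trans
      (transpose-≢ _ t (s≢x ∘ permutation-injective ψ)
        (λ ψs≡t → s≢x (injective (≡.subst (S s) (≡.trans (≡.sym (ext s∈ Ssu)) ψs≡t) Ssu) Sxt)))
      (ext s∈ Ssu)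

    rel′ : ∀ v → R v (transpose (ψ ⟨$⟩ʳ x) t (ψ ⟨$⟩ʳ v))
    -- The swapped points are related through `x`: its current image to `x`, and `x` to its match
    -- `t`.
    rel′ v = R-trans (rel v)
      (transpose-related (R-trans (R-sym (rel x)) (S⇒R Sxt)) (ψ ⟨$⟩ʳ v))

  extend-to-permutation : ∃ λ (ψ : Permutation′ n) →
    (∀ {s t} → S s t → ψ ⟨$⟩ʳ s ≡ t) × (∀ v → R v (ψ ⟨$⟩ʳ v))
  extend-to-permutation with extend-on (allFin n)
  ... | ψ , ext , rel = ψ , ext (∈-allFin _) , rel

-- Reduced walks, midpoints and labels

-- Reduced G x y z k: a walk x, y, …, z with k edges after the edge xy, and
-- never returning immediately along the edge just used.
data Reduced {n} (G : Graph n) : Fin n → Fin n → Fin n → ℕ → Set where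
  edge  : ∀ {x y} → Adj G x y → Reduced G x y y 0
  _⟨_⟩_ : ∀ {x y w z k} → Adj G x y → x ≢ w → Reduced G y w z k → Reduced G x y z (suc k)

infixr 5 _⟨_⟩_

Neighbourhood : ∀ {n} → Graph n → Fin n → Fin n → Set
Neighbourhood G m v = m ≡ v ⊎ Adj G m v

Near : ∀ {n} → Graph n → Fin n → Fin n → Set
Near G = DistLe G 3

Common : ∀ {n} → Graph n → (a d v : Fin n) → Set
Common G a d v = Near G a v × Near G d v

-- The three inequalities only forbid immediate backtracking; in a tree that already makes a, b, m,
-- c, d a path of length 4.
record Midpoint {n} (G : Graph n) (a d m : Fin n) : Set where
  constructor midpoint
  field
    {b c} : Fin n
    ab    : Adj G a b
    bm    : Adj G b m
    mc    : Adj G m c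
    cd    : Adj G c d
    a≢m   : a ≢ m
    b≢c   : b ≢ c
    m≢d   : m ≢ d

Covered : ∀ {n} → Graph n → Fin n → Set
Covered G w = ∃ λ a → ∃ λ d → ∃ λ m → Midpoint G a d m × Neighbourhood G m w

-- The label of v is the set of pairs (a, d) at distance 4 such that v is close
-- to both a and d; it can be read off the cube.
Label⊆ : ∀ {n} → Graph n → Fin n → Fin n → Set
Label⊆ G u v = ∀ {a d m} → Midpoint G a d m → Common G a d u → Common G a d v

record Tree {n} (G : Graph n) : Set where
  field
    path    : ∀ u v → u ≡ v ⊎ ∃₂ λ y k → Reduced G u y v k
    acyclic : ∀ {v y k} → ¬ Reduced G v y v k

-- Reduced walks in graphs without cycles

module _ {n} {G : Graph n} where

  vertices : ∀ {x y z k} → Reduced G x y z k → List (Fin n)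
  vertices (edge {y = y} _)          = y ∷ []
  vertices (_⟨_⟩_ {y = y} _ _ p) = y ∷ vertices p

  vertices-chain : ∀ {x y z k} (p : Reduced G x y z k) → Chain G (x ∷ vertices p)
  vertices-chain (edge a)    = cons a one
  vertices-chain (a ⟨ _ ⟩ p) = cons a (vertices-chain p)

  endpoint∈vertices : ∀ {x y z k} (p : Reduced G x y z k) → z ∈ vertices p
  endpoint∈vertices (edge _)    = here refl
  endpoint∈vertices (_ ⟨ _ ⟩ p) = there (endpoint∈vertices p)

  vertices-head : ∀ {x y z k w ws} (p : Reduced G x y z k) → vertices p ≡ w ∷ ws → w ≡ y
  vertices-head (edge _)    refl = refl
  vertices-head (_ ⟨ _ ⟩ _) refl = refl

  chain-prefix : ∀ ys {x y zs} → Chain G (y ∷ ys ++ x ∷ zs) → Chain G (y ∷ ys ++ x ∷ [])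
  chain-prefix []       (cons a _) = cons a one
  chain-prefix (_ ∷ ys) (cons a c) = cons a (chain-prefix ys c)

  unique-rotate : ∀ xs {x : Fin n} {zs} → Unique (xs ++ x ∷ zs) → Unique (x ∷ xs)
  unique-rotate []       _         = [] ∷ []
  unique-rotate (s ∷ xs) (s∉ ∷ u) with unique-rotate xs u
  ... | x∉ ∷ u′ = ((λ x≡s → All.head (++⁻ʳ xs s∉) (≡.sym x≡s)) ∷ x∉) ∷ ++⁻ˡ xs s∉ ∷ u′

  -- Cut `vertices p` at the occurrence of `x`. As `x ≢ w`, the part before it contains `w`, so
  -- together with `y` there are enough vertices for a cycle.
  close-cycle : ∀ {x y w z k} → Adj G x y → x ≢ w → (p : Reduced G y w z k) →
                Unique (y ∷ vertices p) → x ∈ vertices p → Cycle G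
  close-cycle {x} {y} a x≢w p u x∈ with ∈-∃++ x∈
  ... | []     , _ , eq = contradiction (vertices-head p eq) x≢w
  ... | s ∷ ys , _ , eq = record
    { start = x
    ; rest  = y ∷ s ∷ ys
    ; uniq  = unique-rotate (y ∷ s ∷ ys) (≡.subst (Unique ∘ (y ∷_)) eq u)
    ; long  = s≤s (s≤s z≤n)
    ; chain = cons a (chain-prefix (s ∷ ys) (≡.subst (Chain G ∘ (y ∷_)) eq (vertices-chain p)))
    }

  reduced-unique : ¬ Cycle G → ∀ {x y z k} (p : Reduced G x y z k) → Unique (x ∷ vertices p)
  reduced-unique _ (edge a) = ((λ { refl → irrefl G _ a }) ∷ []) ∷ [] ∷ []
  reduced-unique ¬cyc (a ⟨ x≢w ⟩ p) =
    ((λ { refl → irrefl G _ a }) ∷ ¬Any⇒All¬ _ (¬cyc ∘ close-cycle a x≢w p u)) ∷ u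
    where u = reduced-unique ¬cyc p

  reduced-not-closed : ¬ Cycle G → ∀ {v y k} → ¬ Reduced G v y v k
  reduced-not-closed ¬cyc p with reduced-unique ¬cyc p
  ... | v∉ ∷ _ = All.lookup v∉ (endpoint∈vertices p) refl

  -- Backtracks are cancelled from the far end. Index `j` means `j + 1` edges, so `j < k` says that
  -- the length does not grow.
  walk⇒reduced : ∀ {u v k} → Walk G u v k → u ≡ v ⊎ ∃₂ λ y j → j < k × Reduced G u y v j
  walk⇒reduced here = inj₁ refl
  walk⇒reduced (step {u} a w) with walk⇒reduced w
  ... | inj₁ refl = inj₂ (_ , 0 , s≤s z≤n , edge a)
  ... | inj₂ (y , j , j<k , p) with u ≟ y
  ...   | no  u≢y = inj₂ (_ , suc j , s≤s j<k , a ⟨ u≢y ⟩ p)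
  walk⇒reduced (step a w) | inj₂ (y , zero  , _   , edge _)    | yes refl = inj₁ refl
  walk⇒reduced (step a w) | inj₂ (y , suc j , j<k , _ ⟨ _ ⟩ p) | yes refl =
    inj₂ (_ , j , ℕ.≤-trans (ℕ.n<1+n j) (ℕ.≤-trans (ℕ.<⇒≤ j<k) (ℕ.n≤1+n _)) , p)

  walk⇒path : ∀ {u v k} → Walk G u v k → u ≡ v ⊎ ∃₂ λ y j → Reduced G u y v j
  walk⇒path w = Sum.map₂ (λ (y , j , _ , p) → y , j , p) (walk⇒reduced w)

  reduced⇒walk : ∀ {x y z k} → Reduced G x y z k → Walk G x z (suc k)
  reduced⇒walk (edge a)    = step a here
  reduced⇒walk (a ⟨ _ ⟩ p) = step a (reduced⇒walk p)

  isTree⇒tree : IsTree G → Tree G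
  isTree⇒tree (conn , ¬cyc) = record
    { path    = λ u v → walk⇒path (proj₂ (conn u v))
    ; acyclic = reduced-not-closed ¬cyc
    }

-- Paths and distances in a tree

module TreeProperties {n} {G : Graph n} (T : Tree G) where
  open Tree T

  adjacent⇒≢ : ∀ {u v} → Adj G u v → u ≢ v
  adjacent⇒≢ a refl = irrefl G _ a

  -- The walk from d back to x, followed by the second walk.
  reverse-append : ∀ {x y d v j k} → Reduced G x y d j → Reduced G y x v k →
                   ∃ λ z → Reduced G d z v (j + k)
  reverse-append (edge _) q = _ , q
  reverse-append {v = v} {suc j} {k} (_ ⟨ x≢w ⟩ p) q with p
  ... | edge a = _ , (sym G a ⟨ x≢w ∘ ≡.sym ⟩ q)
  ... | a ⟨ y≢ ⟩ r with reverse-append (a ⟨ y≢ ⟩ r) (sym G a ⟨ x≢w ∘ ≡.sym ⟩ q)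
  ...   | z , s = z , ≡.subst (Reduced G _ z v) (ℕ.+-suc j k) s

  join : ∀ {x y y′ u v j k} → Reduced G x y u j → Reduced G x y′ v k → y ≢ y′ →
         ∃ λ z → Reduced G u z v (j + suc k)
  join (edge a) q y≢y′ = _ , (sym G a ⟨ y≢y′ ⟩ q)
  join p@(a ⟨ _ ⟩ _) q y≢y′ = reverse-append p (sym G a ⟨ y≢y′ ⟩ q)

  reverse : ∀ {x y z k} → Reduced G x y z k → ∃ λ w → Reduced G z w x k
  reverse (edge a) = _ , edge (sym G a)
  reverse {k = k} p@(a ⟨ _ ⟩ _) with reverse-append p (edge (sym G a))
  ... | w , q = w , ≡.subst (Reduced G _ w _) (ℕ.+-identityʳ k) q

  -- Walks that diverge at once join to a closed reduced walk; a shared first edge is stripped.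
  -- Hence every reduced walk realises the distance.
  reduced-length-unique : ∀ {u v y y′ j k} → Reduced G u y v j → Reduced G u y′ v k → j ≡ k
  reduced-length-unique {y = y} {y′} p q with y ≟ y′
  ... | no  y≢y′ = ⊥-elim (acyclic (proj₂ (join p q y≢y′)))
  reduced-length-unique (edge _)    (edge _)    | yes refl = refl
  reduced-length-unique (edge _)    (_ ⟨ _ ⟩ q) | yes refl = ⊥-elim (acyclic q)
  reduced-length-unique (_ ⟨ _ ⟩ p) (edge _)    | yes refl = ⊥-elim (acyclic p)
  reduced-length-unique (_ ⟨ _ ⟩ p) (_ ⟨ _ ⟩ q) | yes refl = ≡.cong suc (reduced-length-unique p q)

  near⇒short : ∀ {u y v k} → Near G u v → Reduced G u y v k → k ≤ 2
  near⇒short (_ , ≤3 , w) p with walk⇒reduced w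
  ... | inj₁ refl = ⊥-elim (acyclic p)
  ... | inj₂ (_ , j , j< , q) =
    ≡.subst (_≤ 2) (reduced-length-unique q p) (s≤s⁻¹ (ℕ.≤-trans j< ≤3))

  near-sym : ∀ {u v} → Near G u v → Near G v u
  near-sym {u} {v} near with u ≟ v
  ... | yes refl = near
  ... | no  u≢v  = proj₂ (sym (P3 G) (u≢v , near))

  -- `Adj` is an arbitrary relation; decidability, here and for `adjacent?`, comes from the length
  -- of the path that the tree supplies.
  near? : ∀ u v → Dec (Near G u v)
  near? u v with path u v
  ... | inj₁ refl = yes (0 , z≤n , here)
  ... | inj₂ (_ , k , p) with k ≤? 2
  ...   | yes k≤2 = yes (suc k , s≤s k≤2 , reduced⇒walk p)
  ...   | no  k≰2 = no λ near → k≰2 (near⇒short near p)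

  adjacent? : ∀ u v → Dec (Adj G u v)
  adjacent? u v with path u v
  ... | inj₁ refl = no (irrefl G u)
  ... | inj₂ (_ , zero  , edge a) = yes a
  ... | inj₂ (_ , suc _ , p) = no λ a → contradiction (reduced-length-unique p (edge a)) λ ()

  -- Closed neighbourhoods of midpoints

  neighbourhood? : ∀ m v → Dec (Neighbourhood G m v)
  neighbourhood? m v = m ≟ v ⊎-dec adjacent? m v

  neighbourhood-sym : ∀ {u v} → Neighbourhood G u v → Neighbourhood G v u
  neighbourhood-sym (inj₁ eq) = inj₁ (≡.sym eq)
  neighbourhood-sym (inj₂ a)  = inj₂ (sym G a)

  midpoint⇒reduced : ∀ {a d m} → (M : Midpoint G a d m) → Reduced G a (Midpoint.b M) d 3
  midpoint⇒reduced (midpoint ab bm mc cd a≢m b≢c m≢d) = ab ⟨ a≢m ⟩ bm ⟨ b≢c ⟩ mc ⟨ m≢d ⟩ edge cd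

  midpoint-sym : ∀ {a d m} → Midpoint G a d m → Midpoint G d a m
  midpoint-sym (midpoint ab bm mc cd a≢m b≢c m≢d) =
    midpoint (sym G cd) (sym G mc) (sym G bm) (sym G ab) (m≢d ∘ ≡.sym) (b≢c ∘ ≡.sym) (a≢m ∘ ≡.sym)

  midpoint⇒¬near : ∀ {a d m} → Midpoint G a d m → ¬ Near G a d
  midpoint⇒¬near M near with near⇒short near (midpoint⇒reduced M)
  ... | s≤s (s≤s ())

  neighbourhood⇒near-end : ∀ {a d m v} → Midpoint G a d m → Neighbourhood G m v → Near G a v
  neighbourhood⇒near-end (midpoint ab bm _ _ _ _ _) (inj₁ refl) = 2 , s≤s (s≤s z≤n) , step ab (step bm here)
  neighbourhood⇒near-end (midpoint ab bm _ _ _ _ _) (inj₂ mv)   = 3 , ℕ.≤-refl , step ab (step bm (step mv here))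

  neighbourhood⇒common : ∀ {a d m v} → Midpoint G a d m → Neighbourhood G m v → Common G a d v
  neighbourhood⇒common M nb = neighbourhood⇒near-end M nb , neighbourhood⇒near-end (midpoint-sym M) nb

  -- Two edges from `a` to `m`, then at least two more away from `b`, give distance at least 4.
  leave-midpoint : ∀ {a d m y v k} → (M : Midpoint G a d m) → Midpoint.b M ≢ y →
                   Reduced G m y v (suc k) → ¬ Near G a v
  leave-midpoint (midpoint ab bm _ _ a≢m _ _) b≢y p near with near⇒short near (ab ⟨ a≢m ⟩ bm ⟨ b≢y ⟩ p)
  ... | s≤s (s≤s ())

  -- A path of two or more edges from `m` cannot begin with both `b` and `c`, so it puts `v` too far
  -- from `a` or from `d`.
  common⇒neighbourhood : ∀ {a d m v} → Midpoint G a d m → Common G a d v → Neighbourhood G m v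
  common⇒neighbourhood {m = m} {v} M (near-a , near-d) with path m v
  ... | inj₁ eq                   = inj₁ eq
  ... | inj₂ (_ , zero  , edge a) = inj₂ a
  ... | inj₂ (y , suc _ , p) with Midpoint.b M ≟ y
  ...   | no  b≢y  = ⊥-elim (leave-midpoint M b≢y p near-a)
  ...   | yes refl = ⊥-elim (leave-midpoint (midpoint-sym M) (Midpoint.b≢c M ∘ ≡.sym) p near-d)

  -- At distance at least 5, common vertices can only be the third and fourth
  -- vertices of the path.
  far-common : ∀ {a x₁ x₂ x₃ d v j} → Adj G a x₁ → Adj G x₁ x₂ → a ≢ x₂ → x₁ ≢ x₃ →
               Reduced G x₂ x₃ d (2 + j) → Common G a d v → v ≡ x₂ ⊎ v ≡ x₃
  far-common {x₁ = x₁} {x₂} {x₃} {v = v} {j} a₁ a₂ a≢x₂ x₁≢x₃ p (near-a , near-d) with path x₂ v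
  ... | inj₁ refl = inj₁ refl
  ... | inj₂ (y , k , q) with x₃ ≟ y
  ...   | no x₃≢y with near⇒short near-d (proj₂ (join p q x₃≢y))
  ...     | s≤s (s≤s le) = contradiction (ℕ.≤-trans (ℕ.m≤n+m (suc k) j) le) λ ()
  far-common _  _  _    _     p _            | inj₂ (_ , zero  , edge _) | yes refl = inj₂ refl
  far-common a₁ a₂ a≢x₂ x₁≢x₃ p (near-a , _) | inj₂ (_ , suc _ , q)      | yes refl
    with near⇒short near-a (a₁ ⟨ a≢x₂ ⟩ a₂ ⟨ x₁≢x₃ ⟩ q)
  ... | s≤s (s≤s ())

  -- Distance 4 against more: `2 + j` leaves at least three edges beyond `x₂`, five or more in all.
  far⇒midpoint-or-reduced : ∀ {a d} → ¬ Near G a d → (∃ (Midpoint G a d)) ⊎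
    (∃ λ x₁ → ∃ λ x₂ → ∃ λ x₃ → ∃ λ j → Adj G a x₁ × Adj G x₁ x₂ × a ≢ x₂ × x₁ ≢ x₃ × Reduced G x₂ x₃ d (2 + j))
  far⇒midpoint-or-reduced {a} {d} far with path a d
  ... | inj₁ refl = ⊥-elim (far (0 , z≤n , here))
  ... | inj₂ (_ , _ , p@(edge _)) = ⊥-elim (far (1 , s≤s z≤n , reduced⇒walk p))
  ... | inj₂ (_ , _ , p@(_ ⟨ _ ⟩ edge _)) = ⊥-elim (far (2 , s≤s (s≤s z≤n) , reduced⇒walk p))
  ... | inj₂ (_ , _ , p@(_ ⟨ _ ⟩ _ ⟨ _ ⟩ edge _)) = ⊥-elim (far (3 , ℕ.≤-refl , reduced⇒walk p))
  ... | inj₂ (_ , _ , (ab ⟨ a≢m ⟩ bm ⟨ b≢c ⟩ mc ⟨ m≢d ⟩ edge cd)) =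
    inj₁ (_ , midpoint ab bm mc cd a≢m b≢c m≢d)
  ... | inj₂ (_ , _ , (a₁ ⟨ ≢₁ ⟩ a₂ ⟨ ≢₂ ⟩ p@(_ ⟨ _ ⟩ _ ⟨ _ ⟩ _))) =
    inj₂ (_ , _ , _ , _ , a₁ , a₂ , ≢₁ , ≢₂ , p)

  three-common⇒midpoint : ∀ {a d u v w} → ¬ Near G a d → u ≢ v → u ≢ w → v ≢ w →
    Common G a d u → Common G a d v → Common G a d w → ∃ (Midpoint G a d)
  three-common⇒midpoint far u≢v u≢w v≢w cu cv cw with far⇒midpoint-or-reduced far
  ... | inj₁ M = M
  ... | inj₂ (_ , _ , _ , _ , a₁ , a₂ , ≢₁ , ≢₂ , p)
    with far-common a₁ a₂ ≢₁ ≢₂ p cu | far-common a₁ a₂ ≢₁ ≢₂ p cv | far-common a₁ a₂ ≢₁ ≢₂ p cw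
  ... | inj₁ refl | inj₁ refl | _         = contradiction refl u≢v
  ... | inj₁ refl | inj₂ refl | inj₁ refl = contradiction refl u≢w
  ... | inj₁ refl | inj₂ refl | inj₂ refl = contradiction refl v≢w
  ... | inj₂ refl | inj₂ refl | _         = contradiction refl u≢v
  ... | inj₂ refl | inj₁ refl | inj₂ refl = contradiction refl u≢w
  ... | inj₂ refl | inj₁ refl | inj₁ refl = contradiction refl v≢w

  other-branch : ∀ {a d m} → Midpoint G a d m → ∀ v →
                 ∃₂ λ e f → Adj G f e × Adj G e m × f ≢ m × e ≢ v
  other-branch (midpoint {b} {c} ab bm mc cd a≢m b≢c m≢d) v with b ≟ v
  ... | no  b≢v  = b , _ , ab , bm , a≢m , b≢v
  ... | yes refl = c , _ , sym G cd , sym G mc , m≢d ∘ ≡.sym , b≢c ∘ ≡.sym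

  other-neighbour : ∀ {a d m} → Midpoint G a d m → ∀ v → ∃ λ e → Adj G m e × e ≢ v
  other-neighbour M v with other-branch M v
  ... | e , _ , _ , em , _ , e≢v = e , sym G em , e≢v

  -- If `m′` were a neighbour of `m`, another neighbour of `m` would complete a triangle. So its
  -- closed neighbourhood determines a midpoint.
  neighbourhood-⊆⇒≡ : ∀ {a d m m′} → Midpoint G a d m →
    (∀ {v} → Neighbourhood G m v → Neighbourhood G m′ v) → m ≡ m′
  neighbourhood-⊆⇒≡ {m = m} {m′} M sub with sub (inj₁ refl)
  ... | inj₁ eq = ≡.sym eq
  ... | inj₂ m′m with other-neighbour M m′
  ...   | e , me , e≢m′ with sub (inj₂ me)
  ...     | inj₁ eq  = contradiction (≡.sym eq) e≢m′
  ...     | inj₂ m′e = ⊥-elim (acyclic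
    (m′m ⟨ e≢m′ ∘ ≡.sym ⟩ me ⟨ adjacent⇒≢ (sym G m′m) ⟩ edge (sym G m′e)))

  -- Outside the degenerate cases, u, x, v, y would form a 4-cycle.
  two-common⇒neighbours : ∀ {u v x y} → x ≢ y → Neighbourhood G u x → Neighbourhood G u y →
    Neighbourhood G v x → Neighbourhood G v y → Neighbourhood G u v
  two-common⇒neighbours {u} {v} x≢y ux uy vx vy with u ≟ v
  ... | yes eq = inj₁ eq
  two-common⇒neighbours x≢y (inj₁ refl) _ vx _ | no _ = neighbourhood-sym vx
  two-common⇒neighbours x≢y (inj₂ ux) _ (inj₁ refl) _ | no _ = inj₂ ux
  two-common⇒neighbours x≢y (inj₂ _) (inj₁ refl) _ vy | no _ = neighbourhood-sym vy
  two-common⇒neighbours x≢y (inj₂ _) (inj₂ uy) _ (inj₁ refl) | no _ = inj₂ uy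
  two-common⇒neighbours x≢y (inj₂ ux) (inj₂ uy) (inj₂ vx) (inj₂ vy) | no u≢v = ⊥-elim (acyclic
    (ux ⟨ u≢v ⟩ sym G vx ⟨ x≢y ⟩ vy ⟨ u≢v ∘ ≡.sym ⟩ edge (sym G uy)))

  midpoint? : ∀ a d m → Dec (Midpoint G a d m)
  midpoint? a d m = map′
    (λ (_ , _ , ab , bm , mc , cd , a≢m , b≢c , m≢d) → midpoint ab bm mc cd a≢m b≢c m≢d)
    (λ (midpoint ab bm mc cd a≢m b≢c m≢d) → _ , _ , ab , bm , mc , cd , a≢m , b≢c , m≢d)
    (any? λ b → any? λ c → adjacent? a b ×-dec adjacent? b m ×-dec adjacent? m c ×-dec adjacent? c d
      ×-dec ¬? (a ≟ m) ×-dec ¬? (b ≟ c) ×-dec ¬? (m ≟ d))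

  -- Covered and uncovered vertices

  covered? : ∀ w → Dec (Covered G w)
  covered? w = any? λ a → any? λ d → any? λ m → midpoint? a d m ×-dec neighbourhood? m w

  edge-meets-midpoint-or-uncovered : ∀ {u v} → Adj G u v →
    (∃₂ λ a d → Midpoint G a d u) ⊎ (∃₂ λ a d → Midpoint G a d v) ⊎ ¬ Covered G u ⊎ ¬ Covered G v
  edge-meets-midpoint-or-uncovered {u} {v} uv with covered? u | covered? v
  ... | no ¬cu | _      = inj₂ (inj₂ (inj₁ ¬cu))
  ... | yes _  | no ¬cv = inj₂ (inj₂ (inj₂ ¬cv))
  ... | yes (_ , _ , _ , M , inj₁ refl) | yes _ = inj₁ (_ , _ , M)
  ... | yes _ | yes (_ , _ , _ , M , inj₁ refl) = inj₂ (inj₁ (_ , _ , M))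
  ... | yes (_ , _ , x , M , inj₂ xu) | yes (_ , _ , y , M′ , inj₂ yv) with x ≟ v | u ≟ y
  ...   | yes refl | _        = inj₂ (inj₁ (_ , _ , M))
  ...   | no  _    | yes refl = inj₁ (_ , _ , M′)
  -- Here `u` itself is a midpoint, of the path e, x, u, v, y.
  ...   | no  x≢v  | no  u≢y with other-neighbour M u
  ...     | e , xe , e≢u = inj₁ (e , y , midpoint (sym G xe) xu uv (sym G yv) e≢u x≢v u≢y)

  far⇒midpoint : ∀ {u v} → ¬ Near G u v → ∃ λ a → ∃ λ d → ∃ (Midpoint G a d)
  far⇒midpoint far with far⇒midpoint-or-reduced far
  ... | inj₁ (_ , M) = _ , _ , _ , M
  ... | inj₂ (_ , _ , _ , _ , a₁ , a₂ , ≢₁ , ≢₂ , (a₃ ⟨ ≢₃ ⟩ a₄ ⟨ _ ⟩ _)) =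
    _ , _ , _ , midpoint a₁ a₂ a₃ a₄ ≢₁ ≢₂ ≢₃

  -- `w` is at least two edges away from `m`. Prefixing the arm at `m` that avoids this path gives
  -- four or more edges; reversed, the walk starts at `w`.
  uncovered⇒endpoint : ∀ {a d m w} → Midpoint G a d m → ¬ Covered G w → ∃₂ λ v z → Midpoint G w v z
  uncovered⇒endpoint {m = m} {w} M ¬cw with path m w
  ... | inj₁ refl               = contradiction (_ , _ , _ , M , inj₁ refl) ¬cw
  ... | inj₂ (_ , _ , edge mw)  = contradiction (_ , _ , _ , M , inj₂ mw) ¬cw
  ... | inj₂ (y , suc _ , p@(_ ⟨ _ ⟩ _)) with other-branch M y
  ...   | e , f , fe , em , f≢m , e≢y with reverse (fe ⟨ f≢m ⟩ em ⟨ e≢y ⟩ p)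
  ...     | _ , (a₁ ⟨ ≢₁ ⟩ a₂ ⟨ ≢₂ ⟩ a₃ ⟨ ≢₃ ⟩ edge a₄)    = _ , _ , midpoint a₁ a₂ a₃ a₄ ≢₁ ≢₂ ≢₃
  ...     | _ , (a₁ ⟨ ≢₁ ⟩ a₂ ⟨ ≢₂ ⟩ a₃ ⟨ ≢₃ ⟩ a₄ ⟨ _ ⟩ _) = _ , _ , midpoint a₁ a₂ a₃ a₄ ≢₁ ≢₂ ≢₃

  -- With a second neighbour `q`, the path q, w, x, z, u would have midpoint `x`, which covers `w`.
  uncovered⇒leaf : ∀ {w v z q} → ¬ Covered G w → (M : Midpoint G w v z) → Adj G w q → Midpoint.b M ≡ q
  uncovered⇒leaf {q = q} ¬cw (midpoint {x} {u} wx xz zu _ w≢z x≢u _) wq with x ≟ q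
  ... | yes x≡q = x≡q
  ... | no  x≢q = contradiction
    (q , u , x , midpoint (sym G wq) wx xz zu (x≢q ∘ ≡.sym) w≢z x≢u , inj₂ (sym G wx)) ¬cw

  uncovered-neighbour : ∀ {a d m w} → Midpoint G a d m → ¬ Covered G w → ∃ (Adj G w)
  uncovered-neighbour M ¬cw with uncovered⇒endpoint M ¬cw
  ... | _ , _ , M′ = _ , Midpoint.ab M′

  uncovered-neighbour-unique : ∀ {a d m w s t} → Midpoint G a d m → ¬ Covered G w →
                               Adj G w s → Adj G w t → s ≡ t
  uncovered-neighbour-unique M ¬cw ws wt with uncovered⇒endpoint M ¬cw
  ... | _ , _ , M′ = ≡.trans (≡.sym (uncovered⇒leaf ¬cw M′ ws)) (uncovered⇒leaf ¬cw M′ wt)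

  uncovered-neighbour-covered : ∀ {a d m w s} → Midpoint G a d m → ¬ Covered G w → Adj G w s → Covered G s
  uncovered-neighbour-covered M ¬cw ws with uncovered⇒endpoint M ¬cw
  ... | v , z , M′ with uncovered⇒leaf ¬cw M′ ws
  ...   | refl = _ , _ , _ , M′ , inj₂ (sym G (Midpoint.bm M′))

  -- At distances 0 and 2 the claim holds because uncovered vertices are leaves; at distances 1 and
  -- 3 an end would be covered.
  near-uncovered⇒same-neighbour : ∀ {a d m w w′ s s′} → Midpoint G a d m → ¬ Covered G w → ¬ Covered G w′ →
    Near G w w′ → Adj G w s → Adj G w′ s′ → s ≡ s′
  near-uncovered⇒same-neighbour {w = w} {w′} M ¬cw ¬cw′ near ws w′s′ with path w w′
  ... | inj₁ refl = uncovered-neighbour-unique M ¬cw ws w′s′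
  ... | inj₂ (_ , _ , edge ww′) = contradiction (uncovered-neighbour-covered M ¬cw ww′) ¬cw′
  ... | inj₂ (_ , _ , (wy ⟨ _ ⟩ edge yw′)) = ≡.trans
    (uncovered-neighbour-unique M ¬cw ws wy) (uncovered-neighbour-unique M ¬cw′ (sym G yw′) w′s′)
  ... | inj₂ (_ , _ , p@(_ ⟨ _ ⟩ _ ⟨ _ ⟩ _ ⟨ _ ⟩ _)) with near⇒short near p
  ...   | s≤s (s≤s ())
  near-uncovered⇒same-neighbour M ¬cw ¬cw′ near ws w′s′
    | inj₂ (_ , _ , (wx ⟨ _ ⟩ _⟨_⟩_ {y = y′} xy′ x≢w′ (edge y′w′))) with uncovered⇒endpoint M ¬cw
  ... | v , z , M′@(midpoint _ xz zu _ _ x≢u _) with uncovered⇒leaf ¬cw M′ wx | y′ ≟ z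
  -- On a path w, x, y′, w′: if y′ is the midpoint `z`, it covers w′; otherwise w′, y′, x, z and the
  -- vertex after z form a path with midpoint x, which covers w.
  ...   | refl | yes refl = contradiction (_ , _ , _ , M′ , inj₂ y′w′) ¬cw′
  ...   | refl | no y′≢z = contradiction
    (_ , _ , _ , midpoint (sym G y′w′) (sym G xy′) xz zu (x≢w′ ∘ ≡.sym) y′≢z x≢u , inj₂ (sym G wx)) ¬cw

  -- If `w` were 3 or more from `m`, a neighbour of `m` off the path would be at distance at least 4
  -- from `w`; distances 0 and 1 would cover `w`. So `m` is two steps away, through `s`.
  near-neighbourhood⇒neighbour-adjacent : ∀ {a d m w s} → Midpoint G a d m → ¬ Covered G w → Adj G w s →
    (∀ {v} → Neighbourhood G m v → Near G w v) → Adj G m s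
  near-neighbourhood⇒neighbour-adjacent {m = m} {w} M ¬cw ws near with path m w
  ... | inj₁ refl = contradiction (_ , _ , _ , M , inj₁ refl) ¬cw
  ... | inj₂ (_ , _ , edge mw) = contradiction (_ , _ , _ , M , inj₂ mw) ¬cw
  ... | inj₂ (_ , _ , (my ⟨ _ ⟩ edge yw)) =
    ≡.subst (Adj G m) (uncovered-neighbour-unique M ¬cw (sym G yw) ws) my
  ... | inj₂ (y , _ , p@(_ ⟨ _ ⟩ _ ⟨ _ ⟩ _)) with other-neighbour M y
  ...   | e , me , e≢y with near⇒short (near-sym (near (inj₂ me))) (sym G me ⟨ e≢y ⟩ p)
  ...     | s≤s (s≤s ())

-- Two trees with the same cube

module SameCube {n} {G H : Graph n} (S : Tree G) (T : Tree H)
  (to   : ∀ {u v} → Near G u v → Near H u v)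
  (from : ∀ {u v} → Near H u v → Near G u v)
  where
  module A = TreeProperties S
  module B = TreeProperties T

  common-to : ∀ {a d v} → Common G a d v → Common H a d v
  common-to (p , q) = to p , to q

  common-from : ∀ {a d v} → Common H a d v → Common G a d v
  common-from (p , q) = from p , from q

  midpoint-to : ∀ {a d m} → Midpoint G a d m → ∃ (Midpoint H a d)
  midpoint-to M@(midpoint _ bm mc _ _ b≢c _) = B.three-common⇒midpoint
    (A.midpoint⇒¬near M ∘ from)
    (A.adjacent⇒≢ bm) b≢c (A.adjacent⇒≢ mc)
    (common-to (A.neighbourhood⇒common M (inj₂ (sym G bm))))
    (common-to (A.neighbourhood⇒common M (inj₁ refl)))
    (common-to (A.neighbourhood⇒common M (inj₂ mc)))

  midpoint-from : ∀ {a d m} → Midpoint H a d m → ∃ (Midpoint G a d)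
  midpoint-from M@(midpoint _ bm mc _ _ b≢c _) = A.three-common⇒midpoint
    (B.midpoint⇒¬near M ∘ to)
    (B.adjacent⇒≢ bm) b≢c (B.adjacent⇒≢ mc)
    (common-from (B.neighbourhood⇒common M (inj₂ (sym H bm))))
    (common-from (B.neighbourhood⇒common M (inj₁ refl)))
    (common-from (B.neighbourhood⇒common M (inj₂ mc)))

  neighbourhood-to : ∀ {a d m m′ v} → Midpoint G a d m → Midpoint H a d m′ →
                     Neighbourhood G m v → Neighbourhood H m′ v
  neighbourhood-to M M′ = B.common⇒neighbourhood M′ ∘ common-to ∘ A.neighbourhood⇒common M

  neighbourhood-from : ∀ {a d m m′ v} → Midpoint G a d m → Midpoint H a d m′ →
                       Neighbourhood H m′ v → Neighbourhood G m v
  neighbourhood-from M M′ = A.common⇒neighbourhood M ∘ common-from ∘ B.neighbourhood⇒common M′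

  covered-from : ∀ {w} → Covered H w → Covered G w
  covered-from (_ , _ , _ , M , nb) with midpoint-from M
  ... | _ , M′ = _ , _ , _ , M′ , neighbourhood-from M′ M nb

  label-from : ∀ {u v} → Label⊆ H u v → Label⊆ G u v
  label-from sub M = common-from ∘ sub (proj₂ (midpoint-to M)) ∘ common-to

-- The partial bijection between the trees

data Matched {n} (G H : Graph n) : Fin n → Fin n → Set where
  mids : ∀ {a d s t} → Midpoint G a d s → Midpoint H a d t → Matched G H s t
  stem : ∀ {w s t} → ¬ Covered G w → ¬ Covered H w → Adj G w s → Adj H w t → Matched G H s t
  leaf : ∀ {w} → ¬ Covered G w → ¬ Covered H w → Matched G H w w

-- Injectivity of the matching thereby becomes functionality with the trees exchanged.
matched-sym : ∀ {n} {G H : Graph n} {s t} → Matched G H s t → Matched H G t s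
matched-sym (mids M M′)         = mids M′ M
matched-sym (stem ¬cg ¬ch g h)  = stem ¬ch ¬cg h g
matched-sym (leaf ¬cg ¬ch)      = leaf ¬ch ¬cg

module Matching {n} {G H : Graph n} (S : Tree G) (T : Tree H)
  (to   : ∀ {u v} → Near G u v → Near H u v)
  (from : ∀ {u v} → Near H u v → Near G u v)
  {a₀ d₀ m₀ m₁} (M₀ : Midpoint G a₀ d₀ m₀) (M₁ : Midpoint H a₀ d₀ m₁)
  where
  open SameCube S T to from

  mid-not-stem : ∀ {a d s w} → Midpoint G a d s → ¬ Covered G w → ¬ Adj G w s
  mid-not-stem M ¬cw ws = ¬cw (_ , _ , _ , M , inj₂ (sym G ws))

  mid-not-leaf : ∀ {a d s} → Midpoint G a d s → ¬ ¬ Covered G s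
  mid-not-leaf M ¬cs = ¬cs (_ , _ , _ , M , inj₁ refl)

  stem-not-leaf : ∀ {w s} → ¬ Covered G w → Adj G w s → ¬ ¬ Covered G s
  stem-not-leaf ¬cw ws ¬cs = ¬cs (A.uncovered-neighbour-covered M₀ ¬cw ws)

  siblings-near : ∀ {w w′ s} → Adj G w s → Adj G w′ s → Near G w w′
  siblings-near ws w′s = 2 , s≤s (s≤s z≤n) , step ws (step (sym G w′s) here)

  mids-functional : ∀ {a d a′ d′ s t t′} → Midpoint G a d s → Midpoint H a d t →
                    Midpoint G a′ d′ s → Midpoint H a′ d′ t′ → t ≡ t′
  mids-functional M N M′ N′ =
    B.neighbourhood-⊆⇒≡ N (neighbourhood-to M′ N′ ∘ neighbourhood-from M N)

  -- The three kinds of source exclude one another, since everything within one step of a midpoint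
  -- is covered and so are stems. Uncovered vertices sharing a stem in `G` are close in both trees,
  -- so they share one in `H`.
  functional : ∀ {s t t′} → Matched G H s t → Matched G H s t′ → t ≡ t′
  functional (mids M N)      (mids M′ N′)      = mids-functional M N M′ N′
  functional (mids M _)      (stem ¬cw _ ws _) = ⊥-elim (mid-not-stem M ¬cw ws)
  functional (mids M _)      (leaf ¬cs _)      = ⊥-elim (mid-not-leaf M ¬cs)
  functional (stem ¬cw _ ws _) (mids M _)      = ⊥-elim (mid-not-stem M ¬cw ws)
  functional (stem ¬cw ¬cw′ ws wt) (stem ¬cx ¬cx′ xs xt) =
    B.near-uncovered⇒same-neighbour M₁ ¬cw′ ¬cx′ (to (siblings-near ws xs)) wt xt
  functional (stem ¬cw _ ws _) (leaf ¬cs _)    = ⊥-elim (stem-not-leaf ¬cw ws ¬cs)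
  functional (leaf ¬cs _)    (mids M _)        = ⊥-elim (mid-not-leaf M ¬cs)
  functional (leaf ¬cs _)    (stem ¬cw _ ws _) = ⊥-elim (stem-not-leaf ¬cw ws ¬cs)
  functional (leaf _ _)      (leaf _ _)        = refl

  -- Adjacent midpoints s and m are the two common elements of their
  -- neighbourhoods, so the corresponding vertices of H are equal or adjacent.
  mids-adjacent : ∀ {a d a′ d′ s t m m′} → Midpoint G a d s → Midpoint H a d t →
    Midpoint G a′ d′ m → Midpoint H a′ d′ m′ → Adj G m s → Neighbourhood H m′ t
  mids-adjacent M N M′ N′ ms = B.two-common⇒neighbours (A.adjacent⇒≢ ms)
    (neighbourhood-to M′ N′ (inj₁ refl)) (neighbourhood-to M′ N′ (inj₂ ms))
    (neighbourhood-to M N (inj₂ (sym G ms))) (neighbourhood-to M N (inj₁ refl))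

  matched-neighbourhood : ∀ {a d m m′ s t} → Matched G H s t → Midpoint G a d m → Midpoint H a d m′ →
                          Neighbourhood G m s → Neighbourhood H m′ t
  matched-neighbourhood (mids M N) M′ N′ (inj₁ refl) = inj₁ (mids-functional M′ N′ M N)
  matched-neighbourhood (mids M N) M′ N′ (inj₂ ms)   = mids-adjacent M N M′ N′ ms
  matched-neighbourhood (stem ¬cw _ ws _) M′ _ (inj₁ refl) = ⊥-elim (mid-not-stem M′ ¬cw ws)
  -- The whole closed neighbourhood of `m` lies within 3 of `w` through `s`; the cube carries this
  -- to `H`, where it forces `m′` next to `t`.
  matched-neighbourhood (stem ¬cw ¬cw′ ws wt) M′ N′ (inj₂ ms) = inj₂
    (B.near-neighbourhood⇒neighbour-adjacent N′ ¬cw′ wt (to ∘ near ∘ neighbourhood-from M′ N′))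
    where
    near : ∀ {v} → Neighbourhood G _ v → Near G _ v
    near (inj₁ refl) = 2 , s≤s (s≤s z≤n) , step ws (step (sym G ms) here)
    near (inj₂ mv)   = 3 , ℕ.≤-refl , step ws (step (sym G ms) (step mv here))
  matched-neighbourhood (leaf _ _) M′ N′ nb = neighbourhood-to M′ N′ nb

  matched-label : ∀ {s t} → Matched G H s t → Label⊆ G s t
  matched-label match M c with midpoint-to M
  ... | _ , N = common-from (B.neighbourhood⇒common N (matched-neighbourhood match M N (A.common⇒neighbourhood M c)))

  -- At a midpoint `u`, labels put `f v` in the closed neighbourhood of `f u`, and injectivity
  -- excludes equality. On an edge with an uncovered end both ends are matched. `f` is left general
  -- so that the inverse permutation fits too.
  matched-preserves-adjacency : ∀ {f : Fin n → Fin n} → (∀ {u v} → f u ≡ f v → u ≡ v) →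
    (∀ {s t} → Matched G H s t → f s ≡ t) → (∀ v → Label⊆ G v (f v)) →
    ∀ {u v} → Adj G u v → Adj H (f u) (f v)
  matched-preserves-adjacency {f} f-injective match label uv = by-cases uv (A.edge-meets-midpoint-or-uncovered uv)
    where
    at-midpoint : ∀ {u v a d} → Adj G u v → Midpoint G a d u → Adj H (f u) (f v)
    at-midpoint {v = v} uv M with midpoint-to M
    ... | _ , N with match (mids M N)
    ...   | refl with B.common⇒neighbourhood N (common-to (label v M (A.neighbourhood⇒common M (inj₂ uv))))
    ...     | inj₁ fu≡fv = ⊥-elim (A.adjacent⇒≢ uv (f-injective fu≡fv))
    ...     | inj₂ fufv  = fufv

    at-leaf : ∀ {u v} → Adj G u v → ¬ Covered G u → Adj H (f u) (f v)
    at-leaf uv ¬cu with ¬cu ∘ covered-from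
    ... | ¬cu′ with B.uncovered-neighbour M₁ ¬cu′
    ...   | _ , ut = ≡.subst₂ (Adj H) (≡.sym (match (leaf ¬cu ¬cu′))) (≡.sym (match (stem ¬cu ¬cu′ uv ut))) ut

    by-cases : ∀ {u v} → Adj G u v →
      (∃₂ λ a d → Midpoint G a d u) ⊎ (∃₂ λ a d → Midpoint G a d v) ⊎ ¬ Covered G u ⊎ ¬ Covered G v →
      Adj H (f u) (f v)
    by-cases uv (inj₁ (_ , _ , M))        = at-midpoint uv M
    by-cases uv (inj₂ (inj₁ (_ , _ , M))) = sym H (at-midpoint (sym G uv) M)
    by-cases uv (inj₂ (inj₂ (inj₁ ¬cu)))  = at-leaf uv ¬cu
    by-cases uv (inj₂ (inj₂ (inj₂ ¬cv)))  = sym H (at-leaf (sym G uv) ¬cv)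

  matched? : ∀ s → Dec (∃ (Matched G H s))
  matched? s with A.covered? s
  ... | no ¬cs = yes (s , leaf ¬cs (¬cs ∘ covered-from))
  ... | yes cs with any? (λ a → any? λ d → A.midpoint? a d s)
  ...   | yes (_ , _ , M) = yes (_ , mids M (proj₂ (midpoint-to M)))
  ...   | no ∄M with any? (λ w → ¬? (A.covered? w) ×-dec A.adjacent? w s)
  ...     | yes (w , ¬cw , ws) =
    yes (_ , stem ¬cw (¬cw ∘ covered-from) ws (proj₂ (B.uncovered-neighbour M₁ (¬cw ∘ covered-from))))
  ...     | no ∄w = no λ where
    (_ , mids M _)        → ∄M (_ , _ , M)
    (_ , stem ¬cw _ ws _) → ∄w (_ , ¬cw , ws)
    (_ , leaf ¬cs _)      → ¬cs cs

-- The isomorphism on a common vertex set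

same-cube⇒isomorphic : ∀ {n} {G H : Graph n} → Tree G → Tree H →
  (∀ {u v} → Near G u v → Near H u v) → (∀ {u v} → Near H u v → Near G u v) →
  ∀ {a d m} → Midpoint G a d m → G ≅ H
same-cube⇒isomorphic {n} {G} {H} S T to from M₀ =
  isomorphism (proj₁ extension) (proj₁ (proj₂ extension)) (proj₂ (proj₂ extension))
  where
  module GH = SameCube S T to from
  module HG = SameCube T S from to
  M₁ = proj₂ (GH.midpoint-to M₀)
  module MGH = Matching S T to from M₀ M₁
  module MHG = Matching T S from to M₁ M₀

  -- Both inclusions are kept because the extension needs a symmetric relation.
  SameLabel : Fin n → Fin n → Set
  SameLabel u v = Label⊆ G u v × Label⊆ G v u

  matched⇒sameLabel : ∀ {s t} → Matched G H s t → SameLabel s t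
  matched⇒sameLabel match = MGH.matched-label match , GH.label-from (MHG.matched-label (matched-sym match))

  extension : ∃ λ (ψ : Permutation′ n) →
    (∀ {s t} → Matched G H s t → ψ ⟨$⟩ʳ s ≡ t) × (∀ v → SameLabel v (ψ ⟨$⟩ʳ v))
  extension = extend-to-permutation {R = SameLabel} MGH.matched? MGH.functional
    (λ p q → MHG.functional (matched-sym p) (matched-sym q)) matched⇒sameLabel
    ((λ _ c → c) , λ _ c → c) (λ (p , q) → q , p)
    λ (p , q) (p′ , q′) → (λ M → p′ M ∘ p M) , λ M → q M ∘ q′ M

  isomorphism : (ψ : Permutation′ n) → (∀ {s t} → Matched G H s t → ψ ⟨$⟩ʳ s ≡ t) →
                (∀ v → SameLabel v (ψ ⟨$⟩ʳ v)) → G ≅ H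
  isomorphism ψ extends labels = ψ , λ u v → adj-to , adj-from
    where
    adj-to : ∀ {u v} → Adj G u v → Adj H (ψ ⟨$⟩ʳ u) (ψ ⟨$⟩ʳ v)
    adj-to = MGH.matched-preserves-adjacency (permutation-injective ψ) extends (λ v → proj₁ (labels v))

    -- The inverse permutation satisfies the same hypotheses with `G` and `H` exchanged.
    adj-from : ∀ {u v} → Adj H (ψ ⟨$⟩ʳ u) (ψ ⟨$⟩ʳ v) → Adj G u v
    adj-from a = ≡.subst₂ (Adj G) (Perm.inverseˡ ψ) (Perm.inverseˡ ψ)
      (MHG.matched-preserves-adjacency (permutation-injective (Perm.flip ψ))
        (λ match → ≡.trans (≡.cong (ψ ⟨$⟩ˡ_) (≡.sym (extends (matched-sym match)))) (Perm.inverseˡ ψ))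
        (λ v → HG.label-from (≡.subst (λ w → Label⊆ G w (ψ ⟨$⟩ˡ v)) (Perm.inverseʳ ψ) (proj₂ (labels (ψ ⟨$⟩ˡ v)))))
        a)

-- Relabelling along a bijection, and the theorem

module Pullback {n m} (f : Permutation n m) (H : Graph m) where
  open Inverse f using () renaming (to to fwd; from to bwd)

  fwd-bwd : ∀ {v} → fwd (bwd v) ≡ v
  fwd-bwd = Inverse.inverseˡ f refl

  bwd-fwd : ∀ {v} → bwd (fwd v) ≡ v
  bwd-fwd = Inverse.inverseʳ f refl

  pullback : Graph n
  pullback = record
    { Adj    = λ u v → Adj H (fwd u) (fwd v)
    ; irrefl = λ v → irrefl H (fwd v)
    ; sym    = sym H
    }

  push-walk : ∀ {u v k} → Walk pullback u v k → Walk H (fwd u) (fwd v) k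
  push-walk here       = here
  push-walk (step a w) = step a (push-walk w)

  pull-walk : ∀ {u v k} → Walk H u v k → Walk pullback (bwd u) (bwd v) k
  pull-walk here       = here
  pull-walk (step a w) = step (≡.subst₂ (Adj H) (≡.sym fwd-bwd) (≡.sym fwd-bwd) a) (pull-walk w)

  pull-walk′ : ∀ {u v k} → Walk H (fwd u) (fwd v) k → Walk pullback u v k
  pull-walk′ w = ≡.subst₂ (λ u v → Walk pullback u v _) bwd-fwd bwd-fwd (pull-walk w)

  push-reduced : ∀ {x y z k} → Reduced pullback x y z k → Reduced H (fwd x) (fwd y) (fwd z) k
  push-reduced (edge a)      = edge a
  push-reduced (a ⟨ x≢w ⟩ p) = a ⟨ x≢w ∘ permutation-injective f ⟩ push-reduced p

  pullback-tree : IsTree H → Tree pullback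
  pullback-tree (conn , ¬cyc) = record
    { path    = λ u v → walk⇒path (pull-walk′ (proj₂ (conn (fwd u) (fwd v))))
    ; acyclic = reduced-not-closed ¬cyc ∘ push-reduced
    }

theorem3p2 : ∀ {n m : ℕ} (T₁ : Graph n) (T₂ : Graph m) →
    IsTree T₁ → IsTree T₂ →
    P3 T₁ ≅ P3 T₂ → ¬ IsComplete (P3 T₁) →
    T₁ ≅ T₂
theorem3p2 {n} T₁ T₂ tree₁ tree₂ (f , iso) incomplete =
  transport (same-cube⇒isomorphic S T near-to near-from (proj₂ (proj₂ (proj₂ centre))))
  where
  open Pullback f T₂
  S = isTree⇒tree tree₁
  T = pullback-tree tree₂
  open TreeProperties S using (near?; far⇒midpoint)

  near-to : ∀ {u v} → Near T₁ u v → Near pullback u v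
  near-to {u} {v} near with u ≟ v
  ... | yes refl = 0 , z≤n , here
  ... | no  u≢v with proj₂ (proj₁ (iso u v) (u≢v , near))
  ...   | k , k≤3 , w = k , k≤3 , pull-walk′ w

  near-from : ∀ {u v} → Near pullback u v → Near T₁ u v
  near-from {u} {v} (k , k≤3 , w) with u ≟ v
  ... | yes refl = 0 , z≤n , here
  ... | no  u≢v = proj₂ (proj₂ (iso u v)
    (u≢v ∘ permutation-injective f , k , k≤3 , push-walk w))

  centre : ∃ λ a → ∃ λ d → ∃ (Midpoint T₁ a d)
  centre with all? (λ u → all? (near? u))
  ... | yes near = contradiction (λ u v u≢v → u≢v , near u v) incomplete
  -- Decidability of `Near` turns the failure of completeness into an explicit far pair.
  ... | no ¬near with ¬∀⟶∃¬ n _ (λ u → all? (near? u)) ¬near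
  ...   | u , ¬near-u with ¬∀⟶∃¬ n _ (near? u) ¬near-u
  ...     | _ , far = far⇒midpoint far

  transport : T₁ ≅ pullback → T₁ ≅ T₂
  transport (ψ , adj) = ψ ∘ₚ f , adj
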